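{- Let $h:\Sigma_4^*\to\Sigma_4^*$ (with $\Sigma_4=\{0,1,2,3\}$) be the morphism $h(0)=012$, $h(1)=302$, $h(2)=031$, $h(3)=321$, and let $\mathcal A=\{010,013,021,030,032,102,121,131,202,212,231,301,303,312,320,323\}$. Then (a) $h^\omega(0)$ contains no subword belonging to $\mathcal A$; and (b) $h^\omega(0)$ contains no subword of any of the forms $0\alpha1\alpha3$, $1\alpha0\alpha2$, $2\alpha3\alpha1$, $3\alpha2\alpha0$ with $\alpha\in\Sigma_4^*$.
   Context: $h^\omega(0)=\lim_n h^n(0)$ is the fixed point of $h$ starting with $0$; subwords are contiguous. -}

module Defs where

open import Data.Nat using (ℕ; zero; suc; _+_)
open import Data.List using (List; []; _∷_; _++_; concatMap; length; lookup)
open import Data.Fin using (Fin; toℕ)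
open import Data.Product using (Σ)
open import Relation.Binary.PropositionalEquality using (_≡_)

data Σ4 : Set where
  c0 c1 c2 c3 : Σ4

Word : Set
Word = List Σ4

h : Σ4 → Word
h c0 = c0 ∷ c1 ∷ c2 ∷ []
h c1 = c3 ∷ c0 ∷ c2 ∷ []
h c2 = c0 ∷ c3 ∷ c1 ∷ []
h c3 = c3 ∷ c2 ∷ c1 ∷ []

h* : Word → Word
h* = concatMap h

hpow : ℕ → Word → Word
hpow zero    w = w
hpow (suc n) w = h* (hpow n w)

-- i-th letter of a finite word (default c0 when out of range; never used
-- out of range below)
at : Word → ℕ → Σ4
at []       _       = c0
at (a ∷ _)  zero    = a
at (_ ∷ w)  (suc i) = at w i

-- The infinite fixed point h^ω(0) = lim h^n(0), as a function ℕ → Σ₄.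
-- Since h(0) begins with 0, h^n(0) is a prefix of h^(n+1)(0), and
-- h^(i+1)(0) has length 3^(i+1) > i, so its i-th letter is the i-th
-- letter of the limit.
hω : ℕ → Σ4
hω i = at (hpow (suc i) (c0 ∷ [])) i

OccursIn-hω : Word → Set
OccursIn-hω u = Σ ℕ λ j → (k : Fin (length u)) → hω (j + toℕ k) ≡ lookup u k

w3 : Σ4 → Σ4 → Σ4 → Word
w3 a b c = a ∷ b ∷ c ∷ []

𝒜 : List Word
𝒜 = w3 c0 c1 c0 ∷ w3 c0 c1 c3 ∷ w3 c0 c2 c1 ∷ w3 c0 c3 c0 ∷
    w3 c0 c3 c2 ∷ w3 c1 c0 c2 ∷ w3 c1 c2 c1 ∷ w3 c1 c3 c1 ∷
    w3 c2 c0 c2 ∷ w3 c2 c1 c2 ∷ w3 c2 c3 c1 ∷ w3 c3 c0 c1 ∷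
    w3 c3 c0 c3 ∷ w3 c3 c1 c2 ∷ w3 c3 c2 c0 ∷ w3 c3 c2 c3 ∷ []

pattern5 : Σ4 → Σ4 → Σ4 → Word → Word
pattern5 a b c α = a ∷ α ++ b ∷ α ++ c ∷ []

-- Write x = h^ω(0). Since x = h(x), the letters x(3s), x(3s+1), x(3s+2) are the three
-- letters of h(x(s)). Every h(a) begins with 0 or 3, ends with 1 or 2, and has middle
-- letter σ(a), where σ swaps 0 ↔ 1 and 2 ↔ 3. Part (a) is then a finite check on the
-- windows of h(a)h(b). For (b), the pairs of adjacent letters determine their position
-- mod 3, so in an occurrence of aαbαc with p = |α| + 1 ≥ 3, the repeated pair after a and
-- after b forces 3 ∣ p. If the occurrence starts at 3s or 3s+2, then a and b are both
-- first or both last letters of images of h, which the four excluded shapes forbid; if it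
-- starts at 3s+1, reading the middle letters gives σ(a)α′σ(b)α′σ(c) at s with period p/3,
-- again an excluded shape. Periods 1 and 2 are checked directly.
module Submission where

open import Defs
open import Data.Bool using (Bool; true; false)
open import Data.Empty using (⊥)
open import Data.Fin using (Fin; zero; suc; toℕ)
open import Data.Fin.Properties using (toℕ<n)
open import Data.List using (List; []; _∷_; _++_; length; lookup)
open import Data.List.Membership.Propositional using (_∈_)
open import Data.List.Properties using (length-++; concatMap-++; ++-assoc; ++-identityʳ)
open import Data.List.Relation.Unary.All as All using (All; []; _∷_)
open import Data.Nat
  using (ℕ; zero; suc; _+_; _*_; _∸_; _^_; _≤_; _<_; NonZero; _≤′_; ≤′-refl; ≤′-step; z≤n; s≤s)
open import Data.Nat.DivMod using (_%_; _/_; _divMod_; result; m≡m%n+[m/n]*n; [m+kn]%n≡m%n)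
open import Data.Nat.Divisibility using (_∣_; divides; quotient-<)
open import Data.Nat.Induction using (<-rec)
open import Data.Nat.Properties
open import Data.Nat.Tactic.RingSolver using (solve-∀)
open import Data.Product using (∃; _×_; _,_)
open import Data.Sum using (inj₁; inj₂)
open import Data.Unit using (⊤; tt)
open import Relation.Binary.PropositionalEquality
open import Relation.Nullary using (¬_)

open ≡-Reasoning

cong₃ : ∀ {A B C D : Set} (f : A → B → C → D) {a a′ b b′ c c′} →
        a ≡ a′ → b ≡ b′ → c ≡ c′ → f a b c ≡ f a′ b′ c′
cong₃ f refl refl refl = refl

m%d≡[n+m]%d⇒d∣n : ∀ m n d .{{_ : NonZero d}} → m % d ≡ (n + m) % d → d ∣ n
m%d≡[n+m]%d⇒d∣n m n d eq = divides ((n + m) / d ∸ m / d) (begin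
  n
    ≡⟨ m+n∸n≡m n m ⟨
  n + m ∸ m
    ≡⟨ cong₂ _∸_ (m≡m%n+[m/n]*n (n + m) d) (m≡m%n+[m/n]*n m d) ⟩
  ((n + m) % d + (n + m) / d * d) ∸ (m % d + m / d * d)
    ≡⟨ cong (λ r → (r + (n + m) / d * d) ∸ (m % d + m / d * d)) eq ⟨
  (m % d + (n + m) / d * d) ∸ (m % d + m / d * d)
    ≡⟨ [m+n]∸[m+o]≡n∸o (m % d) _ _ ⟩
  (n + m) / d * d ∸ m / d * d
    ≡⟨ *-distribʳ-∸ d ((n + m) / d) (m / d) ⟨
  ((n + m) / d ∸ m / d) * d
    ∎)

n<3^n : ∀ n → n < 3 ^ n
n<3^n zero    = s≤s z≤n
n<3^n (suc n) = ≤-<-trans (n<3^n n) (^-monoʳ-< 3 (s≤s (s≤s z≤n)) (n<1+n n))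

t*3+[k+s*3]≡k+[t+s]*3 : ∀ t k s → t * 3 + (k + s * 3) ≡ k + (t + s) * 3
t*3+[k+s*3]≡k+[t+s]*3 = solve-∀

k+[3+n]≡3+[k+n] : ∀ k n → k + (3 + n) ≡ 3 + (k + n)
k+[3+n]≡3+[k+n] = solve-∀

at-++ˡ : ∀ (u v : Word) {i} → i < length u → at (u ++ v) i ≡ at u i
at-++ˡ (a ∷ u) v {zero}  _         = refl
at-++ˡ (a ∷ u) v {suc i} (s≤s i<u) = at-++ˡ u v i<u

at-++ʳ : ∀ (u v : Word) i → at (u ++ v) (length u + i) ≡ at v i
at-++ʳ []      v i = refl
at-++ʳ (a ∷ u) v i = at-++ʳ u v i

length-h : ∀ a → length (h a) ≡ 3
length-h c0 = refl
length-h c1 = refl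
length-h c2 = refl
length-h c3 = refl

length-h* : ∀ w → length (h* w) ≡ 3 * length w
length-h* []      = refl
length-h* (a ∷ w) = begin
  length (h a ++ h* w)         ≡⟨ length-++ (h a) ⟩
  length (h a) + length (h* w) ≡⟨ cong₂ _+_ (length-h a) (length-h* w) ⟩
  3 + 3 * length w             ≡⟨ *-suc 3 (length w) ⟨
  3 * suc (length w)           ∎

at-h* : ∀ w s (k : Fin 3) → s < length w →
        at (h* w) (toℕ k + s * 3) ≡ at (h (at w s)) (toℕ k)
at-h* (a ∷ w) zero k _ = begin
  at (h a ++ h* w) (toℕ k + 0)
    ≡⟨ cong (at (h a ++ h* w)) (+-identityʳ (toℕ k)) ⟩
  at (h a ++ h* w) (toℕ k)
    ≡⟨ at-++ˡ (h a) (h* w) (subst (toℕ k <_) (sym (length-h a)) (toℕ<n k)) ⟩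
  at (h a) (toℕ k) ∎
at-h* (a ∷ w) (suc s) k (s≤s s<w) = begin
  at (h a ++ h* w) (toℕ k + (3 + s * 3))
    ≡⟨ cong (at (h a ++ h* w)) (k+[3+n]≡3+[k+n] (toℕ k) (s * 3)) ⟩
  at (h a ++ h* w) (3 + (toℕ k + s * 3))
    ≡⟨ cong (λ n → at (h a ++ h* w) (n + (toℕ k + s * 3))) (length-h a) ⟨
  at (h a ++ h* w) (length (h a) + (toℕ k + s * 3))
    ≡⟨ at-++ʳ (h a) (h* w) (toℕ k + s * 3) ⟩
  at (h* w) (toℕ k + s * 3)
    ≡⟨ at-h* w s k s<w ⟩
  at (h (at w s)) (toℕ k) ∎

hpow-suc : ∀ n w → hpow (suc n) w ≡ hpow n (h* w)
hpow-suc zero    w = refl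
hpow-suc (suc n) w = cong h* (hpow-suc n w)

hpow-++ : ∀ n u v → hpow n (u ++ v) ≡ hpow n u ++ hpow n v
hpow-++ zero    u v = refl
hpow-++ (suc n) u v = trans (cong h* (hpow-++ n u v)) (concatMap-++ h (hpow n u) (hpow n v))

hⁿ0 : ℕ → Word
hⁿ0 n = hpow n (c0 ∷ [])

length-hⁿ0 : ∀ n → length (hⁿ0 n) ≡ 3 ^ n
length-hⁿ0 zero    = refl
length-hⁿ0 (suc n) = trans (length-h* (hⁿ0 n)) (cong (3 *_) (length-hⁿ0 n))

-- Holds because h(0) begins with 0.
hⁿ0-prefix : ∀ {m n} → m ≤′ n → ∃ λ w → hⁿ0 n ≡ hⁿ0 m ++ w
hⁿ0-prefix ≤′-refl = [] , sym (++-identityʳ _)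
hⁿ0-prefix {m} (≤′-step {n} m≤n) with hⁿ0-prefix m≤n
... | w , prefix = w ++ hpow n (c1 ∷ c2 ∷ []) , (begin
  hⁿ0 (suc n)                                ≡⟨ hpow-suc n (c0 ∷ []) ⟩
  hpow n ((c0 ∷ []) ++ c1 ∷ c2 ∷ [])         ≡⟨ hpow-++ n (c0 ∷ []) (c1 ∷ c2 ∷ []) ⟩
  hⁿ0 n ++ hpow n (c1 ∷ c2 ∷ [])             ≡⟨ cong (_++ hpow n (c1 ∷ c2 ∷ [])) prefix ⟩
  (hⁿ0 m ++ w) ++ hpow n (c1 ∷ c2 ∷ [])      ≡⟨ ++-assoc (hⁿ0 m) w _ ⟩
  hⁿ0 m ++ (w ++ hpow n (c1 ∷ c2 ∷ []))      ∎)

at-hⁿ0-stable : ∀ {m n i} → m ≤ n → i < 3 ^ m → at (hⁿ0 n) i ≡ at (hⁿ0 m) i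
at-hⁿ0-stable {m} {i = i} m≤n i<3ᵐ with hⁿ0-prefix (≤⇒≤′ m≤n)
... | w , prefix =
  trans (cong (λ u → at u i) prefix)
        (at-++ˡ (hⁿ0 m) w (subst (i <_) (sym (length-hⁿ0 m)) i<3ᵐ))

hω-at-hⁿ0 : ∀ n {i} → i < 3 ^ n → hω i ≡ at (hⁿ0 n) i
hω-at-hⁿ0 n {i} i<3ⁿ with ≤-total n (suc i)
... | inj₁ n≤1+i = at-hⁿ0-stable n≤1+i i<3ⁿ
... | inj₂ 1+i≤n = sym (at-hⁿ0-stable 1+i≤n (<-trans (n<1+n i) (n<3^n (suc i))))

hω-block : ∀ s (k : Fin 3) → hω (toℕ k + s * 3) ≡ at (h (hω s)) (toℕ k)
hω-block s k = trans (hω-at-hⁿ0 (2 + s) k+s*3<3²⁺ˢ) (at-h* (hⁿ0 (suc s)) s k s<3¹⁺ˢ′)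
  where
  1+s≤3¹⁺ˢ : suc s ≤ 3 ^ suc s
  1+s≤3¹⁺ˢ = <⇒≤ (n<3^n (suc s))
  s<3¹⁺ˢ′ : s < length (hⁿ0 (suc s))
  s<3¹⁺ˢ′ = subst (s <_) (sym (length-hⁿ0 (suc s))) 1+s≤3¹⁺ˢ
  k+s*3<3²⁺ˢ : toℕ k + s * 3 < 3 ^ (2 + s)
  k+s*3<3²⁺ˢ = <-≤-trans (+-monoˡ-< (s * 3) (toℕ<n k))
                         (≤-trans (*-monoˡ-≤ 3 1+s≤3¹⁺ˢ) (≤-reflexive (*-comm (3 ^ suc s) 3)))

σ : Σ4 → Σ4
σ c0 = c1
σ c1 = c0
σ c2 = c3
σ c3 = c2

σ-involutive : ∀ a → σ (σ a) ≡ a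
σ-involutive c0 = refl
σ-involutive c1 = refl
σ-involutive c2 = refl
σ-involutive c3 = refl

σ-injective : ∀ {a b} → σ a ≡ σ b → a ≡ b
σ-injective {a} {b} σa≡σb = begin
  a         ≡⟨ σ-involutive a ⟨
  σ (σ a)   ≡⟨ cong σ σa≡σb ⟩
  σ (σ b)   ≡⟨ σ-involutive b ⟩
  b         ∎

σ-transpose : ∀ {a b} → σ a ≡ b → a ≡ σ b
σ-transpose {a} σa≡b = trans (sym (σ-involutive a)) (cong σ σa≡b)

data Initial : Σ4 → Set where
  c0-initial : Initial c0
  c3-initial : Initial c3

data Final : Σ4 → Set where
  c1-final : Final c1
  c2-final : Final c2

initial-h : ∀ a → Initial (at (h a) 0)
initial-h c0 = c0-initial
initial-h c1 = c3-initial
initial-h c2 = c0-initial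
initial-h c3 = c3-initial

middle-h : ∀ a → at (h a) 1 ≡ σ a
middle-h c0 = refl
middle-h c1 = refl
middle-h c2 = refl
middle-h c3 = refl

final-h : ∀ a → Final (at (h a) 2)
final-h c0 = c2-final
final-h c1 = c2-final
final-h c2 = c1-final
final-h c3 = c1-final

hω-middle : ∀ s → hω (1 + s * 3) ≡ σ (hω s)
hω-middle s = trans (hω-block s (suc zero)) (middle-h (hω s))

-- The 36 words with distinct adjacent letters, minus the 16 words of 𝒜.
allowed : Σ4 → Σ4 → Σ4 → Bool
allowed c0 c1 c2 = true
allowed c0 c2 c0 = true
allowed c0 c2 c3 = true
allowed c0 c3 c1 = true
allowed c1 c0 c1 = true
allowed c1 c0 c3 = true
allowed c1 c2 c0 = true
allowed c1 c2 c3 = true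
allowed c1 c3 c0 = true
allowed c1 c3 c2 = true
allowed c2 c0 c1 = true
allowed c2 c0 c3 = true
allowed c2 c1 c0 = true
allowed c2 c1 c3 = true
allowed c2 c3 c0 = true
allowed c2 c3 c2 = true
allowed c3 c0 c2 = true
allowed c3 c1 c0 = true
allowed c3 c1 c3 = true
allowed c3 c2 c1 = true
allowed _  _  _  = false

allowed-h : ∀ a → allowed (at (h a) 0) (at (h a) 1) (at (h a) 2) ≡ true
allowed-h c0 = refl
allowed-h c1 = refl
allowed-h c2 = refl
allowed-h c3 = refl

allowed-h-initial : ∀ a {b} → Initial b → allowed (at (h a) 1) (at (h a) 2) b ≡ true
allowed-h-initial c0 c0-initial = refl
allowed-h-initial c0 c3-initial = refl
allowed-h-initial c1 c0-initial = refl
allowed-h-initial c1 c3-initial = refl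
allowed-h-initial c2 c0-initial = refl
allowed-h-initial c2 c3-initial = refl
allowed-h-initial c3 c0-initial = refl
allowed-h-initial c3 c3-initial = refl

allowed-final-h : ∀ {a} → Final a → ∀ b → allowed a (at (h b) 0) (at (h b) 1) ≡ true
allowed-final-h c1-final c0 = refl
allowed-final-h c1-final c1 = refl
allowed-final-h c1-final c2 = refl
allowed-final-h c1-final c3 = refl
allowed-final-h c2-final c0 = refl
allowed-final-h c2-final c1 = refl
allowed-final-h c2-final c2 = refl
allowed-final-h c2-final c3 = refl

allowed-factors : ∀ j → allowed (hω j) (hω (1 + j)) (hω (2 + j)) ≡ true
allowed-factors j with j divMod 3
... | result s zero refl = begin
  allowed (hω (s * 3)) (hω (1 + s * 3)) (hω (2 + s * 3))
    ≡⟨ cong₃ allowed (hω-block s zero) (hω-block s (suc zero)) (hω-block s (suc (suc zero))) ⟩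
  allowed (at (h (hω s)) 0) (at (h (hω s)) 1) (at (h (hω s)) 2)
    ≡⟨ allowed-h (hω s) ⟩
  true ∎
... | result s (suc zero) refl = begin
  allowed (hω (1 + s * 3)) (hω (2 + s * 3)) (hω (suc s * 3))
    ≡⟨ cong₃ allowed (hω-block s (suc zero)) (hω-block s (suc (suc zero))) (hω-block (suc s) zero) ⟩
  allowed (at (h (hω s)) 1) (at (h (hω s)) 2) (at (h (hω (suc s))) 0)
    ≡⟨ allowed-h-initial (hω s) (initial-h (hω (suc s))) ⟩
  true ∎
... | result s (suc (suc zero)) refl = begin
  allowed (hω (2 + s * 3)) (hω (suc s * 3)) (hω (1 + suc s * 3))
    ≡⟨ cong₃ allowed (hω-block s (suc (suc zero))) (hω-block (suc s) zero) (hω-block (suc s) (suc zero)) ⟩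
  allowed (at (h (hω s)) 2) (at (h (hω (suc s))) 0) (at (h (hω (suc s))) 1)
    ≡⟨ allowed-final-h (final-h (hω s)) (hω (suc s)) ⟩
  true ∎

-- The position mod 3 of an adjacent pair of h^ω(0); 0 on pairs that never occur.
phase : Σ4 → Σ4 → ℕ
phase c0 c1 = 0
phase c3 c0 = 0
phase c0 c3 = 0
phase c3 c2 = 0
phase c1 c2 = 1
phase c0 c2 = 1
phase c3 c1 = 1
phase c2 c1 = 1
phase c2 c0 = 2
phase c2 c3 = 2
phase c1 c0 = 2
phase c1 c3 = 2
phase _  _  = 0

phase-h₀ : ∀ a → phase (at (h a) 0) (at (h a) 1) ≡ 0
phase-h₀ c0 = refl
phase-h₀ c1 = refl
phase-h₀ c2 = refl
phase-h₀ c3 = refl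

phase-h₁ : ∀ a → phase (at (h a) 1) (at (h a) 2) ≡ 1
phase-h₁ c0 = refl
phase-h₁ c1 = refl
phase-h₁ c2 = refl
phase-h₁ c3 = refl

phase-final-initial : ∀ {a b} → Final a → Initial b → phase a b ≡ 2
phase-final-initial c1-final c0-initial = refl
phase-final-initial c1-final c3-initial = refl
phase-final-initial c2-final c0-initial = refl
phase-final-initial c2-final c3-initial = refl

phase-hω : ∀ i → phase (hω i) (hω (1 + i)) ≡ i % 3
phase-hω i with i divMod 3
... | result s zero refl = begin
  phase (hω (s * 3)) (hω (1 + s * 3))
    ≡⟨ cong₂ phase (hω-block s zero) (hω-block s (suc zero)) ⟩
  phase (at (h (hω s)) 0) (at (h (hω s)) 1)
    ≡⟨ phase-h₀ (hω s) ⟩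
  0
    ≡⟨ [m+kn]%n≡m%n 0 s 3 ⟨
  (s * 3) % 3 ∎
... | result s (suc zero) refl = begin
  phase (hω (1 + s * 3)) (hω (2 + s * 3))
    ≡⟨ cong₂ phase (hω-block s (suc zero)) (hω-block s (suc (suc zero))) ⟩
  phase (at (h (hω s)) 1) (at (h (hω s)) 2)
    ≡⟨ phase-h₁ (hω s) ⟩
  1
    ≡⟨ [m+kn]%n≡m%n 1 s 3 ⟨
  (1 + s * 3) % 3 ∎
... | result s (suc (suc zero)) refl = begin
  phase (hω (2 + s * 3)) (hω (suc s * 3))
    ≡⟨ cong₂ phase (hω-block s (suc (suc zero))) (hω-block (suc s) zero) ⟩
  phase (at (h (hω s)) 2) (at (h (hω (suc s))) 0)
    ≡⟨ phase-final-initial (final-h (hω s)) (initial-h (hω (suc s))) ⟩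
  2
    ≡⟨ [m+kn]%n≡m%n 2 s 3 ⟨
  (2 + s * 3) % 3 ∎

recurring-pair⇒3∣distance : ∀ i n → hω i ≡ hω (n + i) → hω (1 + i) ≡ hω (1 + (n + i)) →
                            3 ∣ n
recurring-pair⇒3∣distance i n first≡ second≡ = m%d≡[n+m]%d⇒d∣n i n 3 (begin
  i % 3                                 ≡⟨ phase-hω i ⟨
  phase (hω i) (hω (1 + i))             ≡⟨ cong₂ phase first≡ second≡ ⟩
  phase (hω (n + i)) (hω (1 + (n + i))) ≡⟨ phase-hω (n + i) ⟩
  (n + i) % 3                           ∎)

OccursAt : {A : Set} → (ℕ → A) → ℕ → List A → Set
OccursAt x j []      = ⊤
OccursAt x j (a ∷ u) = x j ≡ a × OccursAt x (suc j) u

lookup⇒OccursAt : ∀ {A : Set} {x : ℕ → A} (u : List A) {j} →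
                  (∀ k → x (j + toℕ k) ≡ lookup u k) → OccursAt x j u
lookup⇒OccursAt []              f = tt
lookup⇒OccursAt {x = x} (a ∷ u) {j} f =
  subst (λ i → x i ≡ a) (+-identityʳ j) (f zero) ,
  lookup⇒OccursAt u (λ k → subst (λ i → x i ≡ lookup u k) (+-suc j (toℕ k)) (f (suc k)))

occursIn-hω⇒OccursAt : ∀ {u} → OccursIn-hω u → ∃ λ j → OccursAt hω j u
occursIn-hω⇒OccursAt {u} (j , f) = j , lookup⇒OccursAt u f

OccursAt-++ : ∀ {A : Set} {x : ℕ → A} (u : List A) {v j} →
              OccursAt x j (u ++ v) → OccursAt x j u × OccursAt x (length u + j) v
OccursAt-++ []                      o          = tt , o
OccursAt-++ {x = x} (a ∷ u) {v} {j} (xj≡a , o) with OccursAt-++ u o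
... | ou , ov = (xj≡a , ou) , subst (λ i → OccursAt x i v) (+-suc (length u) j) ov

OccursAt-agree : ∀ {A : Set} {x : ℕ → A} {u : List A} {i i′} →
                 OccursAt x i u → OccursAt x i′ u → ∀ {t} → t < length u → x (t + i) ≡ x (t + i′)
OccursAt-agree {u = a ∷ u} (xi≡a , _) (xi′≡a , _) {zero} _ = trans xi≡a (sym xi′≡a)
OccursAt-agree {x = x} {a ∷ u} {i} {i′} (_ , o) (_ , o′) {suc t} (s≤s t<u) = begin
  x (suc t + i)   ≡⟨ cong x (+-suc t i) ⟨
  x (t + suc i)   ≡⟨ OccursAt-agree o o′ t<u ⟩
  x (t + suc i′)  ≡⟨ cong x (+-suc t i′) ⟩
  x (suc t + i′)  ∎

-- a α b α c occurs in x at position j, where p = |α| + 1.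
record Pattern5At {A : Set} (x : ℕ → A) (j p : ℕ) (a b c : A) : Set where
  constructor mkPattern5At
  field
    first  : x j ≡ a
    second : x (p + j) ≡ b
    third  : x (p + (p + j)) ≡ c
    repeat : ∀ {t} → 0 < t → t < p → x (t + j) ≡ x (t + (p + j))

OccursAt-pattern5 : ∀ {A : Set} {x : ℕ → A} a b c (α : List A) {j} →
                    OccursAt x j (a ∷ α ++ b ∷ α ++ c ∷ []) → Pattern5At x j (suc (length α)) a b c
OccursAt-pattern5 {x = x} a b c α {j} (xj≡a , o) with OccursAt-++ α o
... | oα , (xb , o′) with OccursAt-++ α o′
... | oα′ , (xc , _) = mkPattern5At xj≡a
  (subst (λ i → x i ≡ b) (+-suc m j) xb)
  (subst (λ i → x i ≡ c) (trans (cong (λ i → m + suc i) (+-suc m j)) (+-suc m (suc m + j))) xc)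
  repeat
  where
  m = length α
  repeat : ∀ {t} → 0 < t → t < suc m → x (t + j) ≡ x (t + (suc m + j))
  repeat {suc t} _ (s≤s t<m) = begin
    x (suc t + j)             ≡⟨ cong x (+-suc t j) ⟨
    x (t + suc j)             ≡⟨ OccursAt-agree oα oα′ t<m ⟩
    x (t + suc (m + suc j))   ≡⟨ cong (λ i → x (t + suc i)) (+-suc m j) ⟩
    x (t + suc (suc m + j))   ≡⟨ cong x (+-suc t (suc m + j)) ⟩
    x (suc t + (suc m + j))   ∎

data Excluded : Σ4 → Σ4 → Σ4 → Set where
  0α1α3 : Excluded c0 c1 c3
  1α0α2 : Excluded c1 c0 c2
  2α3α1 : Excluded c2 c3 c1
  3α2α0 : Excluded c3 c2 c0

σ-Excluded : ∀ {a b c} → Excluded a b c → Excluded (σ a) (σ b) (σ c)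
σ-Excluded 0α1α3 = 1α0α2
σ-Excluded 1α0α2 = 0α1α3
σ-Excluded 2α3α1 = 3α2α0
σ-Excluded 3α2α0 = 2α3α1

Excluded-distinct : ∀ {a b c} → Excluded a b c → a ≢ b
Excluded-distinct 0α1α3 ()
Excluded-distinct 1α0α2 ()
Excluded-distinct 2α3α1 ()
Excluded-distinct 3α2α0 ()

Excluded-not-allowed : ∀ {a b c} → Excluded a b c → allowed a b c ≡ false
Excluded-not-allowed 0α1α3 = refl
Excluded-not-allowed 1α0α2 = refl
Excluded-not-allowed 2α3α1 = refl
Excluded-not-allowed 3α2α0 = refl

Excluded-period-2 : ∀ {a b c} → Excluded a b c →
                    ∀ d → allowed a d b ≡ true → allowed b d c ≡ true → ⊥
Excluded-period-2 0α1α3 c0 () _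
Excluded-period-2 0α1α3 c1 () _
Excluded-period-2 0α1α3 c2 () _
Excluded-period-2 0α1α3 c3 _  ()
Excluded-period-2 1α0α2 c0 () _
Excluded-period-2 1α0α2 c1 () _
Excluded-period-2 1α0α2 c2 _  ()
Excluded-period-2 1α0α2 c3 _  ()
Excluded-period-2 2α3α1 c0 _  ()
Excluded-period-2 2α3α1 c1 _  ()
Excluded-period-2 2α3α1 c2 () _
Excluded-period-2 2α3α1 c3 () _
Excluded-period-2 3α2α0 c0 _  ()
Excluded-period-2 3α2α0 c1 () _
Excluded-period-2 3α2α0 c2 () _
Excluded-period-2 3α2α0 c3 () _

Excluded-initial : ∀ {a b c} → Excluded a b c → Initial a → Initial b → ⊥
Excluded-initial 0α1α3 _ ()
Excluded-initial 1α0α2 ()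
Excluded-initial 2α3α1 ()
Excluded-initial 3α2α0 _ ()

Excluded-final : ∀ {a b c} → Excluded a b c → Final a → Final b → ⊥
Excluded-final 0α1α3 ()
Excluded-final 1α0α2 _ ()
Excluded-final 2α3α1 _ ()
Excluded-final 3α2α0 ()

NoExcludedPattern : ℕ → Set
NoExcludedPattern p = ∀ j {a b c} → Excluded a b c → ¬ Pattern5At hω j p a b c

no-excluded-pattern-0 : NoExcludedPattern 0
no-excluded-pattern-0 j e (mkPattern5At refl refl _ _) = Excluded-distinct e refl

no-excluded-pattern-1 : NoExcludedPattern 1
no-excluded-pattern-1 j e (mkPattern5At refl refl refl _)
  with () ← trans (sym (allowed-factors j)) (Excluded-not-allowed e)

no-excluded-pattern-2 : NoExcludedPattern 2
no-excluded-pattern-2 j e (mkPattern5At refl refl refl repeat) =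
  Excluded-period-2 e (hω (1 + j)) (allowed-factors j)
    (subst (λ d → allowed (hω (2 + j)) d (hω (4 + j)) ≡ true)
           (sym (repeat (s≤s z≤n) (s≤s (s≤s z≤n))))
           (allowed-factors (2 + j)))

Pattern5At⇒3∣period : ∀ {j p a b c} → 2 < p → Pattern5At hω j p a b c → 3 ∣ p
Pattern5At⇒3∣period {j} {p} 2<p P = recurring-pair⇒3∣distance (1 + j) p
  (trans (repeat (s≤s z≤n) (<-trans (s≤s (s≤s z≤n)) 2<p)) (cong hω (sym (+-suc p j))))
  (trans (repeat (s≤s z≤n) 2<p) (cong (λ i → hω (suc i)) (sym (+-suc p j))))
  where open Pattern5At P

Pattern5At-tripled-ends : ∀ {s q a b c} (k : Fin 3) → Pattern5At hω (toℕ k + s * 3) (q * 3) a b c →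
                          a ≡ at (h (hω s)) (toℕ k) × b ≡ at (h (hω (q + s))) (toℕ k)
Pattern5At-tripled-ends {s} {q} {b = b} k P =
  trans (sym first) (hω-block s k) ,
  (begin
    b                                  ≡⟨ second ⟨
    hω (q * 3 + (toℕ k + s * 3))       ≡⟨ cong hω (t*3+[k+s*3]≡k+[t+s]*3 q (toℕ k) s) ⟩
    hω (toℕ k + (q + s) * 3)           ≡⟨ hω-block (q + s) k ⟩
    at (h (hω (q + s))) (toℕ k)        ∎)
  where open Pattern5At P

Pattern5At-desubstitute : ∀ {s q a b c} → Pattern5At hω (1 + s * 3) (q * 3) a b c →
                          Pattern5At hω s q (σ a) (σ b) (σ c)
Pattern5At-desubstitute {s} {q} P = mkPattern5At
  (σ-transpose (trans (sym (hω-middle s)) first))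
  (σ-transpose (trans (sym (hω-middle-shift q s)) second))
  (σ-transpose (trans (sym (hω-middle-shift₂ q q s)) third))
  repeat′
  where
  open Pattern5At P
  hω-middle-shift : ∀ t i → hω (t * 3 + (1 + i * 3)) ≡ σ (hω (t + i))
  hω-middle-shift t i = trans (cong hω (t*3+[k+s*3]≡k+[t+s]*3 t 1 i)) (hω-middle (t + i))
  hω-middle-shift₂ : ∀ t t′ i → hω (t * 3 + (t′ * 3 + (1 + i * 3))) ≡ σ (hω (t + (t′ + i)))
  hω-middle-shift₂ t t′ i =
    trans (cong (λ n → hω (t * 3 + n)) (t*3+[k+s*3]≡k+[t+s]*3 t′ 1 i)) (hω-middle-shift t (t′ + i))
  repeat′ : ∀ {t} → 0 < t → t < q → hω (t + s) ≡ hω (t + (q + s))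
  repeat′ {t} 0<t t<q = σ-injective (begin
    σ (hω (t + s))                     ≡⟨ hω-middle-shift t s ⟨
    hω (t * 3 + (1 + s * 3))           ≡⟨ repeat (*-monoˡ-< 3 0<t) (*-monoˡ-< 3 t<q) ⟩
    hω (t * 3 + (q * 3 + (1 + s * 3))) ≡⟨ hω-middle-shift₂ t q s ⟩
    σ (hω (t + (q + s)))               ∎)

NoExcludedPattern-tripled : ∀ {q} → NoExcludedPattern q → NoExcludedPattern (q * 3)
NoExcludedPattern-tripled {q} no-q j e P with j divMod 3
... | result s zero refl with Pattern5At-tripled-ends {s} {q} zero P
...   | refl , refl = Excluded-initial e (initial-h (hω s)) (initial-h (hω (q + s)))
NoExcludedPattern-tripled no-q j e P | result s (suc zero) refl =
  no-q s (σ-Excluded e) (Pattern5At-desubstitute P)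
NoExcludedPattern-tripled {q} no-q j e P | result s (suc (suc zero)) refl
  with Pattern5At-tripled-ends {s} {q} (suc (suc zero)) P
...   | refl , refl = Excluded-final e (final-h (hω s)) (final-h (hω (q + s)))

no-excluded-pattern : ∀ p → NoExcludedPattern p
no-excluded-pattern = <-rec NoExcludedPattern step
  where
  step : ∀ p → (∀ {q} → q < p → NoExcludedPattern q) → NoExcludedPattern p
  step 0 _ = no-excluded-pattern-0
  step 1 _ = no-excluded-pattern-1
  step 2 _ = no-excluded-pattern-2
  step p@(suc (suc (suc _))) shorter j {a} {b} {c} e P =
    NoExcludedPattern-tripled (shorter (quotient-< 3∣p)) j e
      (subst (λ p → Pattern5At hω j p a b c) (_∣_.equality 3∣p) P)
    where
    3∣p : 3 ∣ p
    3∣p = Pattern5At⇒3∣period (s≤s (s≤s (s≤s z≤n))) P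

pattern5-absent : ∀ {a b c} → Excluded a b c → ∀ α → ¬ OccursIn-hω (pattern5 a b c α)
pattern5-absent {a} {b} {c} e α occ with occursIn-hω⇒OccursAt occ
... | j , o = no-excluded-pattern _ j e (OccursAt-pattern5 a b c α o)

w3-absent : ∀ {a b c} → allowed a b c ≡ false → ¬ OccursIn-hω (w3 a b c)
w3-absent not-allowed occ with occursIn-hω⇒OccursAt occ
... | j , (refl , refl , refl , _) with () ← trans (sym (allowed-factors j)) not-allowed

𝒜-absent : All (λ u → ¬ OccursIn-hω u) 𝒜
𝒜-absent = w3-absent refl ∷ w3-absent refl ∷ w3-absent refl ∷ w3-absent refl ∷
           w3-absent refl ∷ w3-absent refl ∷ w3-absent refl ∷ w3-absent refl ∷
           w3-absent refl ∷ w3-absent refl ∷ w3-absent refl ∷ w3-absent refl ∷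
           w3-absent refl ∷ w3-absent refl ∷ w3-absent refl ∷ w3-absent refl ∷ []

lemma16 : ((u : Word) → u ∈ 𝒜 → ¬ OccursIn-hω u)
          × ((α : Word) →
               ¬ OccursIn-hω (pattern5 c0 c1 c3 α)
             × ¬ OccursIn-hω (pattern5 c1 c0 c2 α)
             × ¬ OccursIn-hω (pattern5 c2 c3 c1 α)
             × ¬ OccursIn-hω (pattern5 c3 c2 c0 α))
lemma16 = (λ u → All.lookup 𝒜-absent) ,
          λ α → pattern5-absent 0α1α3 α , pattern5-absent 1α0α2 α ,
                pattern5-absent 2α3α1 α , pattern5-absent 3α2α0 α
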